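{- Let $n\geq 1$, $\ell\geq 1$ and $k\geq 2$ be integers. The maximal distance $D_{n,\ell,k}=\max_{t_1,\ldots,t_k\in\mathcal{T}_{n,\ell}} d(t_1,t_2,\ldots,t_k)$ of $k$ sequence patterns of length $n$ and level $\ell$ is $$D_{n,\ell,k} = n - \left\lceil \frac{n}{\ell^{k-1}}\right\rceil .$$
   Context: Let $N=\{1,\ldots,n\}$ and $L=\{1,\ldots,\ell\}$. A length-$n$ level-$\ell$ sequence is a function $q:N\to L$; the set of all such sequences is $\mathcal{Q}_{n,\ell}$. The symmetric group $S_\ell$ acts on $\mathcal{Q}_{n,\ell}$ by relabeling symbols: $\phi(q)=\phi\circ q$. A length-$n$ level-$\ell$ sequence pattern is an orbit (equivalence class) of this action, and $\mathcal{T}_{n,\ell}$ is the set of all sequence patterns. For $q_1,\ldots,q_k\in\mathcal{Q}_{n,\ell}$, the Hamming distance $d(q_1,\ldots,q_k)$ is the number of indices $i\in N$ such that $q_1(i),\ldots,q_k(i)$ are not all equal. For $t_1,\ldots,t_k\in\mathcal{T}_{n,\ell}$, the distance is $d(t_1,\ldots,t_k)=\min\{d(q_1,\ldots,q_k) : q_j\in t_j \text{ for } 1\le j\le k\}$. The patterns $t_1,\ldots,t_k$ in the maximum are arbitrary elements of $\mathcal{T}_{n,\ell}$ (repetitions are allowed). -}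

module Defs where

open import Data.Fin using (Fin; finToFun; funToFin)
open import Data.Fin.Permutation as Perm
  using (Permutation′; permutation; _⟨$⟩ʳ_; _⟨$⟩ˡ_; inverseˡ; inverseʳ)
open import Data.Fin.Properties using (_≟_; all?; any?; finToFun-funToFin)
open import Data.List using (length; filter; allFin)
open import Data.List.Properties using (length-filter; length-tabulate; filter-≐)
open import Data.Nat using (ℕ; zero; suc; NonZero; _^_; _≤_; z≤n; s≤s)
import Data.Nat.Properties as ℕ
open import Data.Product using (∃; ∃-syntax; Σ-syntax; _×_; _,_; proj₁; proj₂)
open import Function using (_∘_; _⇔_; mk⇔; Equivalence; id)
open import Function.Properties.Equivalence using (⇔-isEquivalence)
open import Level using (0ℓ)
open import Relation.Binary using (Rel; Setoid; IsEquivalence)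
open import Relation.Binary.PropositionalEquality
  using (_≡_; _≗_; refl; sym; trans; cong; subst)
open import Relation.Nullary using (Dec; yes; no; contradiction)
open import Relation.Nullary.Decidable using (map′; _×-dec_; ¬?)
open import Relation.Unary using (Pred; Decidable)

private
  variable
    n ℓ k : ℕ

IsMinimum : Pred ℕ 0ℓ → Pred ℕ 0ℓ
IsMinimum P m = P m × (∀ e → P e → m ≤ e)

IsMaximum : Pred ℕ 0ℓ → Pred ℕ 0ℓ
IsMaximum P m = P m × (∀ e → P e → e ≤ m)

minimum-exists : {P : Pred ℕ 0ℓ} → Decidable P → ∃ P → ∃ (IsMinimum P)
minimum-exists {P} P? (m , pm) = go P P? m pm
  where
  go : (Q : Pred ℕ 0ℓ) → Decidable Q → ∀ m → Q m → ∃ (IsMinimum Q)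
  go Q Q? zero    q = zero , q , λ _ _ → z≤n
  go Q Q? (suc m) q with Q? zero
  ... | yes q₀ = zero , q₀ , λ _ _ → z≤n
  ... | no ¬q₀ with go (Q ∘ suc) (Q? ∘ suc) m q
  ...   | m′ , q′ , min = suc m′ , q′ ,
          λ { zero q₀ → contradiction q₀ ¬q₀ ; (suc e) qe → s≤s (min e qe) }

maximum-exists : {P : Pred ℕ 0ℓ} → Decidable P → ∃ P →
                 ∀ b → (∀ e → P e → e ≤ b) → ∃ (IsMaximum P)
maximum-exists {P} P? (m , pm) zero    bound = zero , subst P (ℕ.n≤0⇒n≡0 (bound m pm)) pm , bound
maximum-exists {P} P? ∃P       (suc b) bound with P? (suc b)
... | yes p = suc b , p , bound
... | no ¬p = maximum-exists P? ∃P b λ e pe →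
        ℕ.≤-pred (ℕ.≤∧≢⇒< (bound e pe) λ { refl → ¬p pe })

minimum-cong : {P Q : Pred ℕ 0ℓ} → (∀ e → P e ⇔ Q e) →
               ∀ {a b} → IsMinimum P a → IsMinimum Q b → a ≡ b
minimum-cong P⇔Q {a} {b} (pa , minP) (qb , minQ) =
  ℕ.≤-antisym (minP b (Equivalence.from (P⇔Q b) qb)) (minQ a (Equivalence.to (P⇔Q a) pa))

Sequence : ℕ → ℕ → Set
Sequence n ℓ = Fin n → Fin ℓ

_·_ : Permutation′ ℓ → Sequence n ℓ → Sequence n ℓ
φ · q = (φ ⟨$⟩ʳ_) ∘ q

-- A pattern is an orbit of this action. It is given by some representative;
-- patterns are compared by their sets of members, see _≈_.
record Pattern (n ℓ : ℕ) : Set where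
  constructor orbit
  field
    representative : Sequence n ℓ

open Pattern public

infix 4 _∈_ _≈_

_∈_ : Sequence n ℓ → Pattern n ℓ → Set
_∈_ {ℓ = ℓ} q t = Σ[ φ ∈ Permutation′ ℓ ] φ · representative t ≗ q

_≈_ : Rel (Pattern n ℓ) 0ℓ
t ≈ t′ = ∀ q → q ∈ t ⇔ q ∈ t′

patternSetoid : ℕ → ℕ → Setoid 0ℓ 0ℓ
patternSetoid n ℓ = record
  { Carrier       = Pattern n ℓ
  ; _≈_           = _≈_
  ; isEquivalence = record
    { refl  = λ q → ⇔.refl
    ; sym   = λ e q → ⇔.sym (e q)
    ; trans = λ e f q → ⇔.trans (e q) (f q)
    }
  }
  where module ⇔ = IsEquivalence (⇔-isEquivalence {0ℓ})

AllEqualAt : (Fin k → Sequence n ℓ) → Fin n → Set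
AllEqualAt q i = ∀ a b → q a i ≡ q b i

allEqualAt? : (q : Fin k → Sequence n ℓ) → Decidable (AllEqualAt q)
allEqualAt? q i = all? λ a → all? λ b → q a i ≟ q b i

hammingDistance : (Fin k → Sequence n ℓ) → ℕ
hammingDistance {n = n} q = length (filter (¬? ∘ allEqualAt? q) (allFin n))

hammingDistance≤n : (q : Fin k → Sequence n ℓ) → hammingDistance q ≤ n
hammingDistance≤n {n = n} q =
  ℕ.≤-trans (length-filter (¬? ∘ allEqualAt? q) (allFin n))
            (ℕ.≤-reflexive (length-tabulate {n = n} id))

hammingDistance-cong : {q q′ : Fin k → Sequence n ℓ} → (∀ j → q j ≗ q′ j) →
                       hammingDistance q ≡ hammingDistance q′
hammingDistance-cong {n = n} {q = q} {q′} eq = cong length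
  (filter-≐ (¬? ∘ allEqualAt? q) (¬? ∘ allEqualAt? q′)
    ( (λ ¬p p → ¬p λ a b → trans (eq a _) (trans (p a b) (sym (eq b _))))
    , (λ ¬p p → ¬p λ a b → trans (sym (eq a _)) (trans (p a b) (eq b _))) )
    (allFin n))

DistanceOfMembers : (Fin k → Pattern n ℓ) → Pred ℕ 0ℓ
DistanceOfMembers {k} {n} {ℓ} t e =
  Σ[ q ∈ (Fin k → Sequence n ℓ) ] (∀ j → q j ∈ t j) × hammingDistance q ≡ e

_∈?_ : (q : Sequence n ℓ) (t : Pattern n ℓ) → Dec (q ∈ t)
_∈?_ {n} {ℓ} q t = map′ to from
  (any? λ c → any? λ d →
    all? (λ x → finToFun c (finToFun d x) ≟ x) ×-dec
    all? (λ x → finToFun d (finToFun c x) ≟ x) ×-dec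
    all? (λ i → finToFun c (representative t i) ≟ q i))
  where
  Code : Fin (ℓ ^ ℓ) → Fin (ℓ ^ ℓ) → Set
  Code c d = (∀ x → finToFun c (finToFun d x) ≡ x)
           × (∀ x → finToFun d (finToFun c x) ≡ x)
           × (∀ i → finToFun c (representative t i) ≡ q i)

  to : (∃[ c ] ∃[ d ] Code c d) → q ∈ t
  to (c , d , cd , dc , eq) = permutation (finToFun c) (finToFun d) cd dc , eq

  from : q ∈ t → ∃[ c ] ∃[ d ] Code c d
  from (φ , eq) = funToFin (φ ⟨$⟩ʳ_) , funToFin (φ ⟨$⟩ˡ_)
    , (λ x → trans (φ≗ _) (trans (cong (φ ⟨$⟩ʳ_) (φ⁻¹≗ x)) (inverseʳ φ)))
    , (λ x → trans (φ⁻¹≗ _) (trans (cong (φ ⟨$⟩ˡ_) (φ≗ x)) (inverseˡ φ)))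
    , (λ i → trans (φ≗ _) (eq i))
    where
    φ≗   = finToFun-funToFin (φ ⟨$⟩ʳ_)
    φ⁻¹≗ = finToFun-funToFin (φ ⟨$⟩ˡ_)

anySequences? : (P : Pred (Fin k → Sequence n ℓ) 0ℓ) → Decidable P →
                (∀ {q q′} → (∀ j → q j ≗ q′ j) → P q → P q′) → Dec (∃ P)
anySequences? {k} {n} {ℓ} P P? resp = map′
  (λ (c , p) → decode c , p)
  (λ (q , p) → encode q , resp (λ j i → sym (decode-encode q j i)) p)
  (any? (P? ∘ decode))
  where
  decode : Fin ((ℓ ^ n) ^ k) → Fin k → Sequence n ℓ
  decode c j = finToFun (finToFun c j)

  encode : (Fin k → Sequence n ℓ) → Fin ((ℓ ^ n) ^ k)
  encode q = funToFin (λ j → funToFin (q j))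

  decode-encode : ∀ q j → decode (encode q) j ≗ q j
  decode-encode q j i = trans
    (cong (λ c → finToFun c i) (finToFun-funToFin (funToFin ∘ q) j))
    (finToFun-funToFin (q j) i)

distanceOfMembers? : (t : Fin k → Pattern n ℓ) → Decidable (DistanceOfMembers t)
distanceOfMembers? t e = anySequences? _
  (λ q → all? (λ j → q j ∈? t j) ×-dec (hammingDistance q ℕ.≟ e))
  (λ eq (q∈t , d≡e) →
      (λ j → proj₁ (q∈t j) , λ i → trans (proj₂ (q∈t j) i) (eq j i))
    , trans (sym (hammingDistance-cong eq)) d≡e)

patternDistance-exists : (t : Fin k → Pattern n ℓ) → ∃ (IsMinimum (DistanceOfMembers t))
patternDistance-exists t = minimum-exists (distanceOfMembers? t)
  (_ , representative ∘ t , (λ j → Perm.id , λ _ → refl) , refl)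

patternDistance : (Fin k → Pattern n ℓ) → ℕ
patternDistance t = proj₁ (patternDistance-exists t)

patternDistance-isMinimum : (t : Fin k → Pattern n ℓ) →
                            IsMinimum (DistanceOfMembers t) (patternDistance t)
patternDistance-isMinimum t = proj₂ (patternDistance-exists t)

patternDistance-cong : {t t′ : Fin k → Pattern n ℓ} → (∀ j → t j ≈ t′ j) →
                       patternDistance t ≡ patternDistance t′
patternDistance-cong {t = t} {t′} t≈t′ = minimum-cong
  (λ e → mk⇔
    (λ (q , q∈t , d) → q , (λ j → Equivalence.to (t≈t′ j (q j)) (q∈t j)) , d)
    (λ (q , q∈t , d) → q , (λ j → Equivalence.from (t≈t′ j (q j)) (q∈t j)) , d))
  (patternDistance-isMinimum t) (patternDistance-isMinimum t′)

patternDistance≤n : (t : Fin k → Pattern n ℓ) → patternDistance t ≤ n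
patternDistance≤n t with patternDistance-isMinimum t
... | (q , _ , d) , _ = subst (_≤ _) d (hammingDistance≤n q)

DistanceOfPatterns : (n ℓ k : ℕ) → Pred ℕ 0ℓ
DistanceOfPatterns n ℓ k e = Σ[ t ∈ (Fin k → Pattern n ℓ) ] patternDistance t ≡ e

distanceOfPatterns? : Decidable (DistanceOfPatterns n ℓ k)
distanceOfPatterns? e = map′
  (λ (q , d) → orbit ∘ q , d)
  (λ (t , d) → representative ∘ t , d)
  (anySequences? _ (λ q → patternDistance (orbit ∘ q) ℕ.≟ e)
    λ eq d → trans (patternDistance-cong λ j r → mk⇔
        (λ (φ , e′) → φ , λ i → trans (cong (φ ⟨$⟩ʳ_) (eq j i)) (e′ i))
        (λ (φ , e′) → φ , λ i → trans (cong (φ ⟨$⟩ʳ_) (sym (eq j i))) (e′ i))) d)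

-- ℓ is nonzero so that patterns exist and the maximum is over a nonempty set.
maximalDistance-exists : ∀ n ℓ k .{{_ : NonZero ℓ}} → ∃ (IsMaximum (DistanceOfPatterns n ℓ k))
maximalDistance-exists n (suc ℓ) k = maximum-exists distanceOfPatterns?
  (_ , (λ _ → orbit λ _ → Fin.zero) , refl)
  n (λ { _ (t , refl) → patternDistance≤n t })

maximalDistance : ∀ n ℓ k .{{_ : NonZero ℓ}} → ℕ
maximalDistance n ℓ k = proj₁ (maximalDistance-exists n ℓ k)

maximalDistance-isMaximum : ∀ n ℓ k .{{_ : NonZero ℓ}} →
                            IsMaximum (DistanceOfPatterns n ℓ k) (maximalDistance n ℓ k)
maximalDistance-isMaximum n ℓ k = proj₂ (maximalDistance-exists n ℓ k)

{-# OPTIONS --safe #-}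

-- Upper bound: fix q₁ and relabel each other q_j by one of the ℓ reflections x ↦ c − x mod ℓ.
-- Every position i is an agreement for exactly one choice of the k − 1 reflections (namely
-- c_j = q_j(i) + q₁(i)), so some choice has at least ⌈n/ℓᵏ⁻¹⌉ agreements.
--
-- Lower bound: let q₁ be constant and let q₂, …, q_k be the base-ℓ digits of i mod ℓᵏ⁻¹. At an
-- agreement all relabelled symbols equal the constant φ₁(q₁), which determines every digit; so all
-- agreements lie in one residue class modulo ℓᵏ⁻¹, which has at most ⌈n/ℓᵏ⁻¹⌉ members below n.
module Submission where

open import Defs
open import Data.Integer using (+_; _-_)
open import Data.Nat using (ℕ; NonZero; _≤_; _^_; _∸_)
open import Data.Nat.Properties using (m^n≢0)
open import Data.Rational.Unnormalised using (_/_; ceiling)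
open import Relation.Binary.PropositionalEquality using (_≡_)

open import Data.Fin using (Fin; zero; suc; toℕ; fromℕ<; finToFun; funToFin; combine)
open import Data.Fin.Permutation as Perm
  using (Permutation′; permutation; _⟨$⟩ʳ_; _⟨$⟩ˡ_; inverseˡ)
open import Data.Fin.Properties
  using (toℕ<n; toℕ-fromℕ<; toℕ-injective; fromℕ<-injective; finToFun-funToFin; funToFin-finToFin;
         ¬∀⟶∃¬)
import Data.Integer as ℤ
import Data.Integer.DivMod as ℤ
import Data.Integer.Properties as ℤ
open import Data.List using (List; []; _∷_; length; filter; allFin)
open import Data.List.Properties using (length-tabulate)
open import Data.List.Relation.Binary.Sublist.Propositional using (⊆-refl)
open import Data.List.Relation.Binary.Sublist.Propositional.Properties
  using (length-mono-≤; filter-⊆; filter⁺)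
open import Data.List.Relation.Unary.All as All using (All; []; _∷_)
import Data.List.Relation.Unary.All.Properties as All
open import Data.List.Relation.Unary.AllPairs using ([]; _∷_)
open import Data.List.Relation.Unary.Unique.Propositional using (Unique)
import Data.List.Relation.Unary.Unique.Propositional.Properties as Unique
open import Data.Nat as ℕ using (zero; suc; _+_; _*_; _<_; z≤n; s≤s; _≤?_; _<?_)
import Data.Nat.DivMod as ℕ
open import Data.Nat.Properties as ℕ hiding (m^n≢0)
open import Data.Product using (∃; _×_; _,_; proj₁; proj₂)
open import Data.Sum using (_⊎_; inj₁; inj₂)
open import Function using (_∘_; id)
open import Level using (0ℓ)
open import Relation.Binary.PropositionalEquality
  using (refl; sym; trans; cong; cong₂; subst; module ≡-Reasoning)
open import Relation.Nullary using (¬_; yes; no; contradiction)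
open import Relation.Nullary.Decidable using (¬?)
open import Relation.Unary using (Pred; Decidable)

private
  variable
    n ℓ k : ℕ
    A : Set

-- Counting lists by fibres, and the pigeonhole principle.

length-filter-+-¬ : {P : Pred A 0ℓ} (P? : Decidable P) (xs : List A) →
                    length (filter P? xs) + length (filter (¬? ∘ P?) xs) ≡ length xs
length-filter-+-¬ P? []       = refl
length-filter-+-¬ P? (x ∷ xs) with P? x
... | yes _ = cong suc (length-filter-+-¬ P? xs)
... | no  _ = trans (+-suc _ _) (cong suc (length-filter-+-¬ P? xs))

length≤1 : {P : Pred A 0ℓ} {xs : List A} → Unique xs → All P xs →
           (∀ {x y} → P x → P y → x ≡ y) → length xs ≤ 1
length≤1 {xs = []}        _                 _             _ = z≤n
length≤1 {xs = _ ∷ []}    _                 _             _ = s≤s z≤n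
length≤1 {xs = _ ∷ _ ∷ _} ((x≢y ∷ _) ∷ _) (px ∷ py ∷ _) P-unique =
  contradiction (P-unique px py) x≢y

fibre : (A → ℕ) → List A → ℕ → List A
fibre f xs c = filter (λ x → f x ≟ c) xs

-- Induction on the number `m` of possible values: split off the fibre over the largest value; `f`
-- is smaller on the remaining elements.
length≤fibres : (f : A → ℕ) (m K : ℕ) (xs : List A) → All (λ x → f x < m) xs →
                (∀ c → c < m → length (fibre f xs c) ≤ K) → length xs ≤ m * K
length≤fibres f zero    K []       _         _     = z≤n
length≤fibres f zero    K (_ ∷ _)  (() ∷ _)  _
length≤fibres f (suc m) K xs       f<1+m     small = begin
  length xs                            ≡⟨ length-filter-+-¬ here? xs ⟨
  length (fibre f xs m) + length rest  ≤⟨ +-mono-≤ (small m ≤-refl) rest≤ ⟩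
  K + m * K                            ∎
  where
  open ≤-Reasoning
  here? = λ x → f x ≟ m
  rest = filter (¬? ∘ here?) xs
  rest≤ : length rest ≤ m * K
  rest≤ = length≤fibres f m K rest
    (All.zipWith (λ (fx<1+m , fx≢m) → ≤∧≢⇒< (m<1+n⇒m≤n fx<1+m) fx≢m)
      (All.filter⁺ (¬? ∘ here?) f<1+m , All.all-filter (¬? ∘ here?) xs))
    -- Dropping the fibre over `m` can only shorten the fibres over smaller values, so the bound `K`
    -- is inherited.
    λ c c<m → ≤-trans
      (length-mono-≤ (filter⁺ _ (λ x → f x ≟ c) (λ { refl → id }) (filter-⊆ (¬? ∘ here?) xs)))
      (small c (m<n⇒m<1+n c<m))

pigeonhole : ∀ {m} (f : Fin n → Fin m) K → m * K < n →
             ∃ λ c → K < length (fibre (toℕ ∘ f) (allFin n) (toℕ c))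
pigeonhole {n} {m} f K m*K<n
  with ¬∀⟶∃¬ m _ (λ c → length (fibre (toℕ ∘ f) (allFin n) (toℕ c)) ≤? K) not-all
  where
  not-all : ¬ (∀ c → length (fibre (toℕ ∘ f) (allFin n) (toℕ c)) ≤ K)
  not-all small = <⇒≱ m*K<n (subst (_≤ m * K) (length-tabulate {n = n} id)
    (length≤fibres (toℕ ∘ f) m K (allFin n) (All.universal (λ i → toℕ<n (f i)) _)
      λ c c<m → subst (λ c → length (fibre (toℕ ∘ f) (allFin n) c) ≤ K)
        (toℕ-fromℕ< c<m) (small (fromℕ< c<m))))
... | c , ≰K = c , ≰⇒> ≰K

-- Reflections of the residues modulo `ℓ`.

-- x + y ≡ c modulo ℓ; for residues, the sum exceeds c by either 0 or ℓ.
SumsTo : Fin ℓ → Fin ℓ → Fin ℓ → Set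
SumsTo {ℓ} x y c = toℕ x + toℕ y ≡ toℕ c ⊎ toℕ x + toℕ y ≡ ℓ + toℕ c

SumsTo-comm : {x y c : Fin ℓ} → SumsTo x y c → SumsTo y x c
SumsTo-comm {x = x} {y} (inj₁ e) = inj₁ (trans (+-comm (toℕ y) (toℕ x)) e)
SumsTo-comm {x = x} {y} (inj₂ e) = inj₂ (trans (+-comm (toℕ y) (toℕ x)) e)

-- From `a + b ≡ c` follows `a ≤ c`, so `b′`, being `ℓ + c - a`, would be at least `ℓ`. This
-- excludes the mixed cases of `SumsTo-unique`, where one sum wraps around and the other does not.
+-overflow : ∀ ℓ a b b′ {c} → b′ < ℓ → a + b ≡ c → ¬ (a + b′ ≡ ℓ + c)
+-overflow ℓ a b b′ {c} b′<ℓ e e′ = <⇒≱ b′<ℓ (+-cancelˡ-≤ a ℓ b′ (begin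
  a + ℓ  ≤⟨ +-monoˡ-≤ ℓ (m+n≤o⇒m≤o a (≤-reflexive e)) ⟩
  c + ℓ  ≡⟨ +-comm c ℓ ⟩
  ℓ + c  ≡⟨ e′ ⟨
  a + b′ ∎))
  where open ≤-Reasoning

SumsTo-unique : {x y y′ c : Fin ℓ} → SumsTo x y c → SumsTo x y′ c → y ≡ y′
SumsTo-unique {x = x} (inj₁ e) (inj₁ e′) =
  toℕ-injective (+-cancelˡ-≡ (toℕ x) _ _ (trans e (sym e′)))
SumsTo-unique {x = x} (inj₂ e) (inj₂ e′) =
  toℕ-injective (+-cancelˡ-≡ (toℕ x) _ _ (trans e (sym e′)))
SumsTo-unique {ℓ} {x} {y} {y′} (inj₁ e) (inj₂ e′) =
  contradiction e′ (+-overflow ℓ (toℕ x) (toℕ y) (toℕ y′) (toℕ<n y′) e)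
SumsTo-unique {ℓ} {x} {y} {y′} (inj₂ e) (inj₁ e′) =
  contradiction e (+-overflow ℓ (toℕ x) (toℕ y′) (toℕ y) (toℕ<n y) e′)

sum : (x y : Fin ℓ) → ∃ (SumsTo x y)
sum {ℓ} x y with toℕ x + toℕ y <? ℓ
... | yes x+y<ℓ = fromℕ< x+y<ℓ , inj₁ (sym (toℕ-fromℕ< x+y<ℓ))
... | no  x+y≮ℓ = fromℕ< d<ℓ , inj₂ (begin
    toℕ x + toℕ y              ≡⟨ m+[n∸m]≡n ℓ≤x+y ⟨
    ℓ + (toℕ x + toℕ y ∸ ℓ)    ≡⟨ cong (ℓ ℕ.+_) (toℕ-fromℕ< d<ℓ) ⟨
    ℓ + toℕ (fromℕ< d<ℓ)       ∎)
  where
  open ≡-Reasoning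
  ℓ≤x+y = ≮⇒≥ x+y≮ℓ
  d<ℓ : toℕ x + toℕ y ∸ ℓ < ℓ
  d<ℓ = +-cancelˡ-< ℓ _ _
    (subst (_< ℓ + ℓ) (sym (m+[n∸m]≡n ℓ≤x+y)) (+-mono-< (toℕ<n x) (toℕ<n y)))

difference : (c x : Fin ℓ) → ∃ λ y → SumsTo x y c
difference {ℓ} c x with toℕ x ≤? toℕ c
... | yes x≤c = fromℕ< d<ℓ , inj₁ (trans (cong (toℕ x ℕ.+_) (toℕ-fromℕ< d<ℓ)) (m+[n∸m]≡n x≤c))
  where
  d<ℓ : toℕ c ∸ toℕ x < ℓ
  d<ℓ = ≤-<-trans (m∸n≤m (toℕ c) (toℕ x)) (toℕ<n c)
... | no x≰c = fromℕ< d<ℓ , inj₂ (trans (cong (toℕ x ℕ.+_) (toℕ-fromℕ< d<ℓ)) (m+[n∸m]≡n x≤ℓ+c))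
  where
  x≤ℓ+c : toℕ x ≤ ℓ + toℕ c
  x≤ℓ+c = ≤-trans (<⇒≤ (toℕ<n x)) (m≤m+n ℓ (toℕ c))
  d<ℓ : ℓ + toℕ c ∸ toℕ x < ℓ
  d<ℓ = +-cancelˡ-< (toℕ x) _ _ (subst (_< toℕ x + ℓ) (sym (m+[n∸m]≡n x≤ℓ+c))
    (subst (ℓ + toℕ c <_) (+-comm ℓ (toℕ x)) (+-monoʳ-< ℓ (≰⇒> x≰c))))

-- The relation `SumsTo x y c` is symmetric in `x` and `y` and determines `y` from `x`, so the map
-- is its own inverse.
reflection : Fin ℓ → Permutation′ ℓ
reflection {ℓ} c = permutation ρ ρ involutive involutive
  where
  ρ : Fin ℓ → Fin ℓ
  ρ x = proj₁ (difference c x)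
  involutive : ∀ x → ρ (ρ x) ≡ x
  involutive x =
    SumsTo-unique {x = ρ x} {c = c} (proj₂ (difference c (ρ x)))
      (SumsTo-comm {x = x} {c = c} (proj₂ (difference c x)))

reflection-SumsTo : {x y c : Fin ℓ} → SumsTo x y c → reflection c ⟨$⟩ʳ x ≡ y
reflection-SumsTo {x = x} {c = c} s = SumsTo-unique {x = x} {c = c} (proj₂ (difference c x)) s

-- Upper bound: some choice of reflections produces many agreements.

agreements : (Fin k → Sequence n ℓ) → List (Fin n)
agreements {n = n} q = filter (allEqualAt? q) (allFin n)

agreements+hammingDistance : (q : Fin k → Sequence n ℓ) →
                             length (agreements q) + hammingDistance q ≡ n
agreements+hammingDistance {n = n} q =
  trans (length-filter-+-¬ (allEqualAt? q) (allFin n)) (length-tabulate {n = n} id)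

allEqualAt-zero : (q : Fin (suc k) → Sequence n ℓ) {i : Fin n} →
                  (∀ j → q (suc j) i ≡ q zero i) → AllEqualAt q i
allEqualAt-zero q e a b = trans (to-zero a) (sym (to-zero b))
  where
  to-zero : ∀ a → q a _ ≡ q zero _
  to-zero zero    = refl
  to-zero (suc j) = e j

-- In the application `suc K` is ⌈n/ℓᵏ⌉; the hypothesis `ℓ ^ k * K < n` says that `K` is below the
-- ceiling without mentioning division.
members-with-many-agreements :
  (t : Fin (suc k) → Pattern n ℓ) (K : ℕ) → ℓ ^ k * K < n →
  ∃ λ (q : Fin (suc k) → Sequence n ℓ) → (∀ j → q j ∈ t j) × K < length (agreements q)
members-with-many-agreements {k} {n} {ℓ} t K small = q , q∈t ,
  -- All positions whose code is `c` are agreements of `q`, so this fibre is a sublist of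
  -- `agreements q`.
  <-≤-trans K<fibre (length-mono-≤ (filter⁺ (λ i → toℕ (code i) ≟ toℕ c) (allEqualAt? q)
    (λ { refl → agrees }) (⊆-refl {x = allFin n})))
  where
  r : Fin (suc k) → Sequence n ℓ
  r = representative ∘ t

  -- The tuple of reflection constants that turns position `i` into an agreement, packed into one
  -- number for the pigeonhole argument.
  code : Fin n → Fin (ℓ ^ k)
  code i = funToFin λ j → proj₁ (sum (r (suc j) i) (r zero i))

  c : Fin (ℓ ^ k)
  c = proj₁ (pigeonhole code K small)

  K<fibre : K < length (fibre (toℕ ∘ code) (allFin n) (toℕ c))
  K<fibre = proj₂ (pigeonhole code K small)

  q : Fin (suc k) → Sequence n ℓ
  q zero    = r zero
  q (suc j) = reflection (finToFun c j) · r (suc j)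

  q∈t : ∀ j → q j ∈ t j
  q∈t zero    = Perm.id , λ _ → refl
  q∈t (suc j) = reflection (finToFun c j) , λ _ → refl

  agrees : ∀ {i} → toℕ (code i) ≡ toℕ c → AllEqualAt q i
  agrees {i} code≡c = allEqualAt-zero q λ j → reflection-SumsTo {c = finToFun c j}
    (subst (SumsTo (r (suc j) i) (r zero i))
      (trans (sym (finToFun-funToFin _ j)) (cong (λ d → finToFun d j) (toℕ-injective code≡c)))
      (proj₂ (sum (r (suc j) i) (r zero i))))

hammingDistance≡ : (q : Fin k → Sequence n ℓ) → hammingDistance q ≡ n ∸ length (agreements q)
hammingDistance≡ q = trans (sym (m+n∸m≡n (length (agreements q)) (hammingDistance q)))
  (cong (_∸ length (agreements q)) (agreements+hammingDistance q))

patternDistance≤ : (t : Fin (suc k) → Pattern n ℓ) (K : ℕ) → ℓ ^ k * K < n →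
                   patternDistance t ≤ n ∸ suc K
patternDistance≤ {n = n} t K small =
  let q , q∈t , K<a = members-with-many-agreements t K small
      open ≤-Reasoning
  in begin
  patternDistance t          ≤⟨ proj₂ (patternDistance-isMinimum t) _ (q , q∈t , refl) ⟩
  hammingDistance q          ≡⟨ hammingDistance≡ q ⟩
  n ∸ length (agreements q)  ≤⟨ ∸-monoʳ-≤ n K<a ⟩
  n ∸ suc K                  ∎

-- Lower bound: patterns built from base-`ℓ` digits.

funToFin-cong : {f g : Fin k → Fin ℓ} → (∀ j → f j ≡ g j) → funToFin f ≡ funToFin g
funToFin-cong {k = zero}  _ = refl
funToFin-cong {k = suc _} e = cong₂ combine (e zero) (funToFin-cong (e ∘ suc))

finToFun-injective : ∀ ℓ k {c d : Fin (ℓ ^ k)} →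
                     (∀ (j : Fin k) → finToFun {ℓ} c j ≡ finToFun d j) → c ≡ d
finToFun-injective ℓ k {c} {d} e = trans (sym (funToFin-finToFin {k} {ℓ} c))
  (trans (funToFin-cong {k} {ℓ} e) (funToFin-finToFin {k} {ℓ} d))

permutation-injective : (φ : Permutation′ ℓ) {x y : Fin ℓ} → φ ⟨$⟩ʳ x ≡ φ ⟨$⟩ʳ y → x ≡ y
permutation-injective φ e = trans (sym (inverseˡ φ)) (trans (cong (φ ⟨$⟩ˡ_) e) (inverseˡ φ))

module _ (n ℓ k : ℕ) .{{ℓ≢0 : NonZero ℓ}} where

  private instance
    ℓ^k≢0 : NonZero (ℓ ^ k)
    ℓ^k≢0 = m^n≢0 ℓ k

  digits : Fin (suc k) → Sequence n ℓ
  digits zero    _ = fromℕ< (ℕ.>-nonZero⁻¹ ℓ)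
  digits (suc j) i = finToFun (toℕ i ℕ.mod (ℓ ^ k)) j

  -- At both positions the relabelled digit `j` equals the image of the constant symbol under
  -- `φ zero`. Since `φ (suc j)` is injective, the two positions share every digit.
  agreement⇒congruent : {q : Fin (suc k) → Sequence n ℓ} → (∀ j → q j ∈ orbit (digits j)) →
                        {i i′ : Fin n} → AllEqualAt q i → AllEqualAt q i′ →
                        toℕ i ℕ.% ℓ ^ k ≡ toℕ i′ ℕ.% ℓ ^ k
  agreement⇒congruent {q} q∈ {i} {i′} eq eq′ =
    fromℕ<-injective _ _ (ℕ.m%n<n (toℕ i) (ℓ ^ k)) (ℕ.m%n<n (toℕ i′) (ℓ ^ k))
      (finToFun-injective ℓ k λ j → permutation-injective (φ (suc j)) (begin
        φ (suc j) ⟨$⟩ʳ digits (suc j) i   ≡⟨ proj₂ (q∈ (suc j)) i ⟩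
        q (suc j) i                       ≡⟨ eq (suc j) zero ⟩
        q zero i                          ≡⟨ proj₂ (q∈ zero) i ⟨
        -- Row zero is constant, so `digits zero i` and `digits zero i′` agree by computation; this
        -- links the two positions.
        φ zero ⟨$⟩ʳ digits zero i         ≡⟨ proj₂ (q∈ zero) i′ ⟩
        q zero i′                         ≡⟨ eq′ zero (suc j) ⟩
        q (suc j) i′                      ≡⟨ proj₂ (q∈ (suc j)) i′ ⟨
        φ (suc j) ⟨$⟩ʳ digits (suc j) i′  ∎))
    where
    open ≡-Reasoning
    φ : Fin (suc k) → Permutation′ ℓ
    φ j = proj₁ (q∈ j)

  -- Cut the positions into blocks of length `ℓ ^ k`; at most `C` are needed. Agreements share their
  -- remainder, and the block is the quotient, so each block holds at most one.
  agreements-digits≤ : {q : Fin (suc k) → Sequence n ℓ} → (∀ j → q j ∈ orbit (digits j)) →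
                       ∀ C → n ≤ C * ℓ ^ k → length (agreements q) ≤ C
  agreements-digits≤ {q} q∈ C n≤C*M = subst (_ ≤_) (*-identityʳ C)
    (length≤fibres block C 1 (agreements q)
      (All.universal (λ i → ℕ.m<n*o⇒m/o<n (<-≤-trans (toℕ<n i) n≤C*M)) _)
      λ c _ → length≤1 {P = λ i → AllEqualAt q i × block i ≡ c}
        (Unique.filter⁺ (block≟ c) (Unique.filter⁺ (allEqualAt? q) (Unique.allFin⁺ n)))
        (All.zip ( All.filter⁺ (block≟ c) (All.all-filter (allEqualAt? q) (allFin n))
                 , All.all-filter (block≟ c) (agreements q)))
        λ (eq , b≡c) (eq′ , b′≡c) → toℕ-injective
          (divMod-injective (agreement⇒congruent q∈ eq eq′) (trans b≡c (sym b′≡c))))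
    where
    block : Fin n → ℕ
    block i = toℕ i ℕ./ (ℓ ^ k)
    block≟ : ∀ c → Decidable (λ i → block i ≡ c)
    block≟ c i = block i ≟ c
    divMod-injective : ∀ {a b} → a ℕ.% ℓ ^ k ≡ b ℕ.% ℓ ^ k → a ℕ./ (ℓ ^ k) ≡ b ℕ./ (ℓ ^ k) → a ≡ b
    divMod-injective {a} {b} %≡ /≡ = trans (ℕ.m≡m%n+[m/n]*n a (ℓ ^ k))
      (trans (cong₂ (λ r d → r ℕ.+ d * ℓ ^ k) %≡ /≡) (sym (ℕ.m≡m%n+[m/n]*n b (ℓ ^ k))))

  patternDistance-digits≥ : ∀ C → n ≤ C * ℓ ^ k → n ∸ C ≤ patternDistance (orbit ∘ digits)
  patternDistance-digits≥ C n≤C*M =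
    let (q , q∈ , d≡) , _ = patternDistance-isMinimum (orbit ∘ digits)
        open ≤-Reasoning
    in begin
    n ∸ C                             ≤⟨ ∸-monoʳ-≤ n (agreements-digits≤ q∈ C n≤C*M) ⟩
    n ∸ length (agreements q)         ≡⟨ hammingDistance≡ q ⟨
    hammingDistance q                 ≡⟨ d≡ ⟩
    patternDistance (orbit ∘ digits)  ∎

-- Combining the bounds, and identifying the ceiling.

-- Here ⌈n/ℓᵏ⌉ appears as the least `D` with `n ≤ D * ℓ ^ k`: that `C` satisfies the inequality
-- feeds the lower bound, and that nothing smaller does feeds the upper bound.
maximalDistance≡ : ∀ n ℓ k .{{_ : NonZero ℓ}} {C} → IsMinimum (λ D → n ≤ D * ℓ ^ k) C →
                   maximalDistance n ℓ (suc k) ≡ n ∸ C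
maximalDistance≡ n ℓ k {C} (n≤C*M , least) =
  let (t , d≡max) , greatest = maximalDistance-isMaximum n ℓ (suc k)
  in ≤-antisym
    (subst (_≤ n ∸ C) d≡max (upper t C least))
    (≤-trans (patternDistance-digits≥ n ℓ k C n≤C*M) (greatest _ (orbit ∘ digits n ℓ k , refl)))
  where
  upper : ∀ t C → (∀ D → n ≤ D * ℓ ^ k → C ≤ D) → patternDistance {suc k} {n} {ℓ} t ≤ n ∸ C
  upper t zero    _     = patternDistance≤n t
  -- By minimality `K` itself fails the inequality, which is the strict bound that
  -- `patternDistance≤` asks for.
  upper t (suc K) least = patternDistance≤ t K (≰⇒> λ n≤M*K →
    1+n≰n (least K (subst (n ≤_) (*-comm (ℓ ^ k) K) n≤M*K)))

-- The ceiling is minus the floor of the negated fraction, and integer division by a positive number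
-- rounds down. The case split follows the remainder of `suc n`, as that division does.
/ℕ-minimum : ∀ n d .{{_ : NonZero d}} →
             ∃ λ c → (ℤ.- + n) ℤ./ℕ d ≡ ℤ.- + c × IsMinimum (λ D → n ≤ D * d) c
/ℕ-minimum zero    (suc _) = 0 , refl , z≤n , λ _ _ → z≤n
/ℕ-minimum (suc n) d with suc n ℕ.% d | ℕ.m%n<n (suc n) d | ℕ.m≡m%n+[m/n]*n (suc n) d
... | zero  | _   | eq = _ , refl , ≤-reflexive eq ,
  λ D n≤D*d → *-cancelʳ-≤ (suc n ℕ./ d) D d (≤-trans (≤-reflexive (sym eq)) n≤D*d)
-- With a positive remainder the quotient times `d` falls short of `suc n`, so any admissible `D`
-- exceeds the quotient.
... | suc r | r<d | eq = suc (suc n ℕ./ d) , refl ,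
  ≤-trans (≤-reflexive eq) (+-monoˡ-≤ _ (<⇒≤ r<d)) ,
  λ D n≤D*d → *-cancelʳ-< d (suc n ℕ./ d) D (<-≤-trans (s≤s (m≤n+m _ r))
    (≤-trans (≤-reflexive (sym eq)) n≤D*d))

ceiling-minimum : ∀ n d .{{_ : NonZero d}} →
                  ∃ λ c → ceiling (+ n / d) ≡ + c × IsMinimum (λ D → n ≤ D * d) c
ceiling-minimum n d@(suc _) with /ℕ-minimum n d
... | c , eq , isMin = c , trans
  (cong ℤ.-_ (trans (ℤ.div-pos-is-/ℕ (ℤ.- + n) d) eq)) (ℤ.neg-involutive (+ c)) , isMin

∸-ceiling : ∀ n d .{{_ : NonZero d}} {m} → (∀ {c} → IsMinimum (λ D → n ≤ D * d) c → m ≡ n ∸ c) →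
            + m ≡ + n - ceiling (+ n / d)
∸-ceiling n d {m} m≡ =
  let c , ceil≡c , isMin = ceiling-minimum n d
      open ≡-Reasoning
  in begin
  + m                      ≡⟨ cong +_ (m≡ isMin) ⟩
  -- Truncated subtraction is exact here: `n ≤ n * d`, so minimality gives `c ≤ n`.
  + (n ∸ c)                ≡⟨ ℤ.⊖-≥ (proj₂ isMin n (m≤m*n n d)) ⟨
  n ℤ.⊖ c                  ≡⟨ ℤ.m-n≡m⊖n n c ⟨
  + n - + c                ≡⟨ cong (λ z → + n - z) ceil≡c ⟨
  + n - ceiling (+ n / d)  ∎

theorem4 : (n ℓ k : ℕ) .{{_ : NonZero n}} .{{_ : NonZero ℓ}} → 2 ≤ k →
    + maximalDistance n ℓ k ≡ + n - ceiling (_/_ (+ n) (ℓ ^ (k ∸ 1)) {{m^n≢0 ℓ (k ∸ 1)}})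
theorem4 n ℓ (suc k) _ = ∸-ceiling n (ℓ ^ k) {{m^n≢0 ℓ k}} (maximalDistance≡ n ℓ k)
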